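{- Let $\preceq$ be a computable partial order on $\mathbb N$. Then there exist a set $A\le_T\emptyset'$ and sets $B_0,B_1,\dots\subseteq\mathbb N$ such that $$B_i\equiv_{\rm bfo}A\qquad\text{for every }i\in\mathbb N,$$ and, for all $i,j\in\mathbb N$, $$B_i\le_1 B_j\quad\text{if and only if}\quad i\preceq j.$$ Hence the function $i\mapsto\deg_1(B_i)$ is an order-embedding of $(\mathbb N,\preceq)$ into the partially ordered set of $1$-degrees contained in the bounded finite-one degree of $A$.
   Context: All sets are subsets of $\mathbb N=\{0,1,\dots\}$; $\emptyset'$ is the Turing jump of the empty set. A partial order $\preceq$ (reflexive, antisymmetric, transitive) on $\mathbb N$ is computable if $\{(i,j):i\preceq j\}$ is a computable set. For $A,B\subseteq\mathbb N$: $A\le_1 B$ means there is a total computable injective $f:\mathbb N\to\mathbb N$ with $x\in A\iff f(x)\in B$ for all $x$. $A\le_{\rm bfo}B$ means there are a total computable $f:\mathbb N\to\mathbb N$ and a constant $c\ge1$ with $x\in A\iff f(x)\in B$ for all $x$ and $|f^{ -1}(y)|\le c$ for all $y$. For $r\in\{1,{\rm bfo}\}$, $A\equiv_r B$ means $A\le_r B$ and $B\le_r A$. The equivalence classes of $\equiv_1$ are the $1$-degrees ($\deg_1(X)$ is that of $X$), those of $\equiv_{\rm bfo}$ the bounded finite-one degrees. Since $\le_1$ implies $\le_{\rm bfo}$, each bounded finite-one degree is a union of $1$-degrees; these are partially ordered by $\deg_1(X)\le\deg_1(Y)\iff X\le_1 Y$. An order-embedding is a map preserving and reflecting the order. -}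

module Defs where

open import Data.Nat using (ℕ; zero; suc; _+_; _≤_; _<_; _≥_)
open import Data.Nat.Properties using (+-identityʳ; +-suc; +-comm; suc-injective)
open import Data.List using (List; length)
open import Data.List.Relation.Unary.All using (All)
open import Data.List.Relation.Unary.Unique.Propositional using (Unique)
open import Data.Product using (Σ; ∃-syntax; _×_; _,_; proj₁; proj₂)
open import Data.Sum using (_⊎_)
open import Function using (id; _∘_)
open import Function.Bundles using (_⇔_; mk⇔; module Equivalence)
open import Function.Definitions using (Injective)
open import Level using (0ℓ) renaming (suc to lsuc)
open import Relation.Binary.Bundles using (Poset)
open import Relation.Binary.Core using (Rel)
open import Relation.Binary.PropositionalEquality
  using (_≡_; refl; sym; trans; cong; subst)
open import Relation.Nullary using (¬_)
open import Relation.Unary using (Pred; _∈_; _∉_; ∅)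

-- Cantor's pairing bijection ℕ × ℕ → ℕ.  `unpair` walks along the diagonals;
-- `pair-unpair` and `unpair-pair` show that the two are mutually inverse.

triangle : ℕ → ℕ
triangle zero    = zero
triangle (suc n) = suc n + triangle n

pair : ℕ → ℕ → ℕ
pair x y = triangle (x + y) + y

next : ℕ × ℕ → ℕ × ℕ
next (zero  , y) = suc y , zero
next (suc x , y) = x , suc y

unpair : ℕ → ℕ × ℕ
unpair zero    = zero , zero
unpair (suc n) = next (unpair n)

left right : ℕ → ℕ
left  = proj₁ ∘ unpair
right = proj₂ ∘ unpair

pair-next : ∀ x y → pair (proj₁ (next (x , y))) (proj₂ (next (x , y))) ≡ suc (pair x y)
pair-next zero y
  rewrite +-identityʳ y | +-identityʳ (y + triangle y) = cong suc (+-comm y (triangle y))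
pair-next (suc x) y
  rewrite +-suc x y = +-suc _ y

pair-unpair : ∀ n → pair (left n) (right n) ≡ n
pair-unpair zero    = refl
pair-unpair (suc n) = trans (pair-next (left n) (right n)) (cong suc (pair-unpair n))

unpair-pair : ∀ x y → unpair (pair x y) ≡ (x , y)
unpair-pair x y = go (pair x y) x y refl
  where
  go : ∀ n x y → pair x y ≡ n → unpair n ≡ (x , y)
  go zero    zero    zero    _  = refl
  go (suc n) (suc x) zero    eq =
    cong next (go n zero x (suc-injective (trans (sym (pair-next zero x)) eq)))
  go (suc n) x       (suc y) eq =
    cong next (go n (suc x) y (suc-injective (trans (sym (pair-next (suc x) y)) eq)))
  go zero    (suc x) zero    ()
  go zero    x       (suc y) eq with trans (sym (pair-next (suc x) y)) eq
  ... | ()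

-- Programs for the partial recursive functions with an oracle.  Every program
-- has one argument; several arguments are passed through `pair`.

data Code : Set where
  zeroᶜ succᶜ leftᶜ rightᶜ oracleᶜ : Code
  pairᶜ compᶜ precᶜ                : Code → Code → Code
  muᶜ                              : Code → Code

-- Eval B c x y : program c with oracle B halts on input x with output y.
-- Rec B f g a n y : the function defined from f and g by primitive recursion,
-- with parameter a, has value y at n.

mutual
  data Eval (B : Pred ℕ 0ℓ) : Code → ℕ → ℕ → Set where
    zero-ev    : ∀ {x} → Eval B zeroᶜ x 0
    succ-ev    : ∀ {x} → Eval B succᶜ x (suc x)
    left-ev    : ∀ {x} → Eval B leftᶜ x (left x)
    right-ev   : ∀ {x} → Eval B rightᶜ x (right x)
    oracle-yes : ∀ {x} → x ∈ B → Eval B oracleᶜ x 1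
    oracle-no  : ∀ {x} → x ∉ B → Eval B oracleᶜ x 0
    pair-ev    : ∀ {f g x y z} → Eval B f x y → Eval B g x z →
                 Eval B (pairᶜ f g) x (pair y z)
    comp-ev    : ∀ {f g x y z} → Eval B g x y → Eval B f y z →
                 Eval B (compᶜ f g) x z
    prec-ev    : ∀ {f g x y} → Rec B f g (left x) (right x) y →
                 Eval B (precᶜ f g) x y
    mu-ev      : ∀ {f x n} → Eval B f (pair x n) 0 →
                 (∀ m → m < n → ∃[ k ] Eval B f (pair x m) (suc k)) →
                 Eval B (muᶜ f) x n

  data Rec (B : Pred ℕ 0ℓ) (f g : Code) (a : ℕ) : ℕ → ℕ → Set where
    rec-zero : ∀ {y} → Eval B f a y → Rec B f g a zero y
    rec-suc  : ∀ {n r y} → Rec B f g a n r → Eval B g (pair a (pair n r)) y →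
               Rec B f g a (suc n) y

-- The Gödel number of a program.

encode : Code → ℕ
encode zeroᶜ       = pair 0 0
encode succᶜ       = pair 1 0
encode leftᶜ       = pair 2 0
encode rightᶜ      = pair 3 0
encode oracleᶜ     = pair 4 0
encode (pairᶜ f g) = pair 5 (pair (encode f) (encode g))
encode (compᶜ f g) = pair 6 (pair (encode f) (encode g))
encode (precᶜ f g) = pair 7 (pair (encode f) (encode g))
encode (muᶜ f)     = pair 8 (encode f)

-- The Turing jump {e : Φₑᴮ(e)↓}.  A number that is not the Gödel number of a
-- program is an index of the nowhere defined function.

infix 9 _′

_′ : Pred ℕ 0ℓ → Pred ℕ 0ℓ
(B ′) e = ∃[ c ] (encode c ≡ e × ∃[ y ] Eval B c e y)

-- The graph of the characteristic function of A.

χ : Pred ℕ 0ℓ → ℕ → ℕ → Set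
χ A x y = (x ∈ A × y ≡ 1) ⊎ (x ∉ A × y ≡ 0)

-- A program run with the empty oracle is an ordinary program.

Computable : (ℕ → ℕ) → Set
Computable f = ∃[ c ] ∀ x → Eval ∅ c x (f x)

ComputableSet : Pred ℕ 0ℓ → Set
ComputableSet A = ∃[ f ] (Computable f × (∀ x → χ A x (f x)))

ComputableRel : Rel ℕ 0ℓ → Set
ComputableRel R = ComputableSet (λ n → R (left n) (right n))

-- Turing reducibility: the program does not diverge on any x, and the value it
-- outputs is that of the characteristic function of A.  "Does not diverge" is
-- classically the same as "halts".  A positive existence claim would
-- constructively amount to deciding membership in A, which for A ≤T ∅ ′ is not
-- available in general.

infix 4 _≤T_ _≤₁_ _≤bfo_ _≡₁_ _≡bfo_

_≤T_ : Pred ℕ 0ℓ → Pred ℕ 0ℓ → Set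
A ≤T B = ∃[ c ] ∀ x → ¬ ¬ (∃[ y ] Eval B c x y) × (∀ y → Eval B c x y → χ A x y)

_≤₁_ : Pred ℕ 0ℓ → Pred ℕ 0ℓ → Set
A ≤₁ B = ∃[ f ] (Computable f × Injective _≡_ _≡_ f × (∀ x → x ∈ A ⇔ f x ∈ B))

-- |f⁻¹(y)| ≤ c : a list of pairwise distinct preimages of y has length at most c.

FibresBounded : (ℕ → ℕ) → ℕ → Set
FibresBounded f c =
  ∀ y (xs : List ℕ) → Unique xs → All (λ x → f x ≡ y) xs → length xs ≤ c

_≤bfo_ : Pred ℕ 0ℓ → Pred ℕ 0ℓ → Set
A ≤bfo B = ∃[ f ] ∃[ c ]
  (c ≥ 1 × Computable f × (∀ x → x ∈ A ⇔ f x ∈ B) × FibresBounded f c)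

_≡₁_ : Pred ℕ 0ℓ → Pred ℕ 0ℓ → Set
A ≡₁ B = A ≤₁ B × B ≤₁ A

_≡bfo_ : Pred ℕ 0ℓ → Pred ℕ 0ℓ → Set
A ≡bfo B = A ≤bfo B × B ≤bfo A

≤₁-refl : ∀ A → A ≤₁ A
≤₁-refl A =
    id
  , (pairᶜ leftᶜ rightᶜ ,
     λ x → subst (Eval ∅ _ x) (pair-unpair x) (pair-ev left-ev right-ev))
  , id
  , λ x → mk⇔ id id

≤₁-trans : ∀ A B C → A ≤₁ B → B ≤₁ C → A ≤₁ C
≤₁-trans A B C (f , (c , cf) , f-inj , f-red) (g , (d , dg) , g-inj , g-red) =
    g ∘ f
  , (compᶜ d c , λ x → comp-ev (cf x) (dg (f x)))
  , f-inj ∘ g-inj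
  , λ x → mk⇔ (Equivalence.to (g-red (f x)) ∘ Equivalence.to (f-red x))
              (Equivalence.from (f-red x) ∘ Equivalence.from (g-red (f x)))

-- The partially ordered set of 1-degrees contained in the bounded finite-one
-- degree of A.  A 1-degree is given by a representative, and two
-- representatives are equal as degrees when they are 1-equivalent.

1-degreesIn : Pred ℕ 0ℓ → Poset (lsuc 0ℓ) 0ℓ 0ℓ
1-degreesIn A = record
  { Carrier        = Σ (Pred ℕ 0ℓ) (λ X → X ≡bfo A)
  ; _≈_            = λ X Y → proj₁ X ≡₁ proj₁ Y
  ; _≤_            = λ X Y → proj₁ X ≤₁ proj₁ Y
  ; isPartialOrder = record
    { isPreorder = record
      { isEquivalence = record
        { refl  = λ {(X , _)} → ≤₁-refl X , ≤₁-refl X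
        ; sym   = λ (p , q) → q , p
        ; trans = λ {(X , _)} {(Y , _)} {(Z , _)} (p , q) (r , s) →
                    ≤₁-trans X Y Z p r , ≤₁-trans Z Y X s q
        }
      ; reflexive = proj₁
      ; trans     = λ {(X , _)} {(Y , _)} {(Z , _)} → ≤₁-trans X Y Z
      }
    ; antisym = _,_
    }
  }

{-# OPTIONS --safe #-}
module Submission where

-- A set G ≤T ∅ ′ (`Generic`) is built by finite extension.  Requirement r = pair i e runs
-- program e on pair r l, where l bounds everything decided so far; the value v (0 if there is
-- none) puts x = pair r (l + left v) into G, and every other number from l up to the next bound,
-- which exceeds v, stays out.  Since ∅ ′ only answers halting questions, v is found as the least
-- w such that "program e has a value above w" fails.
--
-- Copies s repeats each x ∈ G once or twice, according to s x ∈ {0, 1}.  If s ≤ s′ pointwise,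
-- then Copies s ≤₁ Copies s′, and all Copies s are bfo-equivalent.  Suppose that s x = 1 and
-- s′ x = 0 for all x in row i (left (left x) = i), and that an injective computable f reduces
-- Copies s to Copies s′.  As f is injective, a program can search for an x ≥ l in row i such that
-- f maps both copies of x to numbers ≥ l.  For the requirement pair i e of this program, x is the
-- only element of G with a copy between l and the value of the search, so f maps both copies of x
-- to the single copy of x, a contradiction.  With s x = 1 if and only if the row of x is ⪯ i, this
-- gives the family B i.

open import Defs
open import Data.Fin using (Fin; zero; suc; toℕ; fromℕ<)
open import Data.Fin.Properties using (injective⇒≤; pigeonhole; toℕ-fromℕ<)
open import Data.List using (List; _∷_; lookup)
open import Data.List.Membership.Propositional.Properties using (∈-lookup)
open import Data.List.Relation.Unary.All as All using ()
open import Data.List.Relation.Unary.AllPairs using (_∷_)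
open import Data.List.Relation.Unary.Unique.Propositional using (Unique)
open import Data.Nat using (ℕ; zero; suc; pred; _+_; _∸_; _≤_; _<_; z≤n; s≤s; _≤?_)
open import Data.Nat.Properties
open import Data.Product using (Σ; Σ-syntax; ∃-syntax; _×_; _,_; proj₁; proj₂; uncurry)
open import Data.Sum using (_⊎_; inj₁; inj₂; [_,_]′)
open import Function using (id; _∘_)
open import Function.Bundles using (_⇔_; mk⇔; module Equivalence)
open import Function.Definitions using (Injective)
open import Level using (0ℓ)
open import Relation.Binary.Bundles using (Poset)
open import Relation.Binary.Core using (Rel)
open import Relation.Binary.Definitions using (Tri; tri<; tri≈; tri>)
open import Relation.Binary.Morphism.Structures using (IsOrderMonomorphism)
open import Relation.Binary.PropositionalEquality
  using (_≡_; refl; sym; trans; cong; cong₂; subst; subst₂)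
open import Relation.Binary.Structures using (IsPartialOrder)
open import Relation.Nullary using (¬_; contradiction)
open import Relation.Nullary.Decidable using (decidable-stable)
open import Relation.Unary using (Pred; ∅; _∈_; _∉_)

-- Pairing

left-pair : ∀ x y → left (pair x y) ≡ x
left-pair x y = cong proj₁ (unpair-pair x y)

right-pair : ∀ x y → right (pair x y) ≡ y
right-pair x y = cong proj₂ (unpair-pair x y)

pair-injective : ∀ {x y x′ y′} → pair x y ≡ pair x′ y′ → x ≡ x′ × y ≡ y′
pair-injective {x} {y} {x′} {y′} eq =
    trans (sym (left-pair x y)) (trans (cong left eq) (left-pair x′ y′))
  , trans (sym (right-pair x y)) (trans (cong right eq) (right-pair x′ y′))

triangle-mono : ∀ {m n} → m ≤ n → triangle m ≤ triangle n
triangle-mono z≤n       = z≤n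
triangle-mono (s≤s m≤n) = +-mono-≤ (s≤s m≤n) (triangle-mono m≤n)

pair-mono : ∀ {x y x′ y′} → x ≤ x′ → y ≤ y′ → pair x y ≤ pair x′ y′
pair-mono x≤x′ y≤y′ = +-mono-≤ (triangle-mono (+-mono-≤ x≤x′ y≤y′)) y≤y′

right≤pair : ∀ x y → y ≤ pair x y
right≤pair x y = m≤n+m y _

right≤ : ∀ n → right n ≤ n
right≤ n = subst (right n ≤_) (pair-unpair n) (right≤pair (left n) (right n))

n≤triangle : ∀ n → n ≤ triangle n
n≤triangle zero    = z≤n
n≤triangle (suc n) = m≤m+n (suc n) _

left≤ : ∀ n → left n ≤ n
left≤ n = subst (left n ≤_) (pair-unpair n)
  (≤-trans (m≤m+n _ (right n)) (≤-trans (n≤triangle _) (m≤m+n _ (right n))))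

-- Determinism of evaluation

module _ {B : Pred ℕ 0ℓ} where

  eval-det : ∀ c {x y z} → Eval B c x y → Eval B c x z → y ≡ z
  rec-det  : ∀ f g {a n y z} → Rec B f g a n y → Rec B f g a n z → y ≡ z

  eval-det zeroᶜ zero-ev zero-ev = refl
  eval-det succᶜ succ-ev succ-ev = refl
  eval-det leftᶜ left-ev left-ev = refl
  eval-det rightᶜ right-ev right-ev = refl
  eval-det oracleᶜ (oracle-yes _) (oracle-yes _) = refl
  eval-det oracleᶜ (oracle-yes p) (oracle-no ¬p) = contradiction p ¬p
  eval-det oracleᶜ (oracle-no ¬p) (oracle-yes p) = contradiction p ¬p
  eval-det oracleᶜ (oracle-no _) (oracle-no _) = refl
  eval-det (pairᶜ f g) (pair-ev p q) (pair-ev p′ q′) =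
    cong₂ pair (eval-det f p p′) (eval-det g q q′)
  eval-det (compᶜ f g) (comp-ev p q) (comp-ev p′ q′) with eval-det g p p′
  ... | refl = eval-det f q q′
  eval-det (precᶜ f g) (prec-ev p) (prec-ev p′) = rec-det f g p p′
  eval-det (muᶜ f) {y = m} {z = n} (mu-ev p p<) (mu-ev q q<) with <-cmp m n
  ... | tri≈ _ m≡n _ = m≡n
  ... | tri< m<n _ _ = contradiction (eval-det f p (proj₂ (q< m m<n))) λ ()
  ... | tri> _ _ n<m = contradiction (eval-det f q (proj₂ (p< n n<m))) λ ()

  rec-det f g (rec-zero p) (rec-zero p′) = eval-det f p p′
  rec-det f g (rec-suc p q) (rec-suc p′ q′) with rec-det f g p p′
  ... | refl = eval-det g q q′

-- Closure properties of computable functions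

ComputableIn : Pred ℕ 0ℓ → (ℕ → ℕ) → Set
ComputableIn B f = ∃[ c ] ∀ x → Eval B c x (f x)

ComputableIn₂ : Pred ℕ 0ℓ → (ℕ → ℕ → ℕ) → Set
ComputableIn₂ B f = ComputableIn B (λ p → f (left p) (right p))

ComputableIn₃ : Pred ℕ 0ℓ → (ℕ → ℕ → ℕ → ℕ) → Set
ComputableIn₃ B f = ComputableIn B (λ p → f (left p) (left (right p)) (right (right p)))

-- Hard-wires an input into a program. Its Gödel number is computable from `n`, which gives the
-- instance of the s-m-n theorem behind `request-computable`.
constᶜ : ℕ → Code
constᶜ zero    = zeroᶜ
constᶜ (suc n) = compᶜ succᶜ (constᶜ n)

module _ {B : Pred ℕ 0ℓ} where

  constᶜ-eval : ∀ n {x} → Eval B (constᶜ n) x n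
  constᶜ-eval zero    = zero-ev
  constᶜ-eval (suc n) = comp-ev (constᶜ-eval n) succ-ev

  eval₂ : ∀ f ((c , _) : ComputableIn₂ B f) x y → Eval B c (pair x y) (f x y)
  eval₂ f (c , h) x y =
    subst (Eval B c (pair x y)) (cong₂ f (left-pair x y) (right-pair x y)) (h (pair x y))

  eval₃ : ∀ f ((c , _) : ComputableIn₃ B f) x y z →
          Eval B c (pair x (pair y z)) (f x y z)
  eval₃ f (c , h) x y z = subst (Eval B c (pair x (pair y z))) value (h (pair x (pair y z)))
    where
    value : (let p = pair x (pair y z)) →
            f (left p) (left (right p)) (right (right p)) ≡ f x y z
    value rewrite unpair-pair x (pair y z) | unpair-pair y z = refl

  ext-computable : ∀ {f g} → (∀ x → f x ≡ g x) → ComputableIn B f → ComputableIn B g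
  ext-computable f≡g (c , h) = c , λ x → subst (Eval B c x) (f≡g x) (h x)

  id-computable : ComputableIn B id
  id-computable =
    ext-computable pair-unpair (pairᶜ leftᶜ rightᶜ , λ _ → pair-ev left-ev right-ev)

  const-computable : ∀ n → ComputableIn B (λ _ → n)
  const-computable n = constᶜ n , λ _ → constᶜ-eval n

  comp-computable : ∀ {f g} → ComputableIn B f → ComputableIn B g → ComputableIn B (f ∘ g)
  comp-computable {g = g} (c , f-ev) (d , g-ev) =
    compᶜ c d , λ x → comp-ev (g-ev x) (f-ev (g x))

  left-computable : ∀ {f} → ComputableIn B f → ComputableIn B (left ∘ f)
  left-computable = comp-computable (leftᶜ , λ _ → left-ev)

  right-computable : ∀ {f} → ComputableIn B f → ComputableIn B (right ∘ f)
  right-computable = comp-computable (rightᶜ , λ _ → right-ev)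

  suc-computable : ∀ {f} → ComputableIn B f → ComputableIn B (suc ∘ f)
  suc-computable = comp-computable (succᶜ , λ _ → succ-ev)

  pair-computable : ∀ {f g} → ComputableIn B f → ComputableIn B g →
                    ComputableIn B (λ x → pair (f x) (g x))
  pair-computable (c , f-ev) (d , g-ev) = pairᶜ c d , λ x → pair-ev (f-ev x) (g-ev x)

  comp₂-computable : ∀ h {f g} → ComputableIn₂ B h → ComputableIn B f → ComputableIn B g →
                     ComputableIn B (λ x → h (f x) (g x))
  comp₂-computable h {f} {g} hᶜ fᶜ gᶜ =
    ext-computable (λ x → cong₂ h (left-pair (f x) (g x)) (right-pair (f x) (g x)))
      (comp-computable hᶜ (pair-computable fᶜ gᶜ))

  -- `h` may be any function that satisfies the recursion equations, so existing functions such as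
  -- `_∸_` are covered as they stand.
  prec-computable : ∀ {f} (g : ℕ → ℕ → ℕ → ℕ) (h : ℕ → ℕ → ℕ) →
                    ComputableIn B f → ComputableIn₃ B g →
                    (∀ a → f a ≡ h a 0) → (∀ a n → g a n (h a n) ≡ h a (suc n)) →
                    ComputableIn₂ B h
  prec-computable g h (c , f-ev) (d , g-ev) h-zero h-suc =
    precᶜ c d , λ p → prec-ev (rec (left p) (right p))
    where
    rec : ∀ a n → Rec B c d a n (h a n)
    rec a zero    = rec-zero (subst (Eval B c a) (h-zero a) (f-ev a))
    rec a (suc n) = rec-suc (rec a n)
      (subst (Eval B d _) (h-suc a n) (eval₃ g (d , g-ev) a n (h a n)))

  +-computable : ComputableIn₂ B _+_
  +-computable = prec-computable (λ _ _ r → suc r) _+_ id-computable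
    (suc-computable (right-computable (right-computable id-computable)))
    (λ a → sym (+-identityʳ a)) (λ a n → sym (+-suc a n))

  pred-computable : ComputableIn B pred
  pred-computable = comp₂-computable (λ _ n → pred n)
    (prec-computable (λ _ n _ → n) (λ _ n → pred n) (const-computable 0)
      (left-computable (right-computable id-computable)) (λ _ → refl) (λ _ _ → refl))
    (const-computable 0) id-computable

  ∸-computable : ComputableIn₂ B _∸_
  ∸-computable = prec-computable (λ _ _ r → pred r) _∸_ id-computable
    (comp-computable pred-computable (right-computable (right-computable id-computable)))
    (λ _ → refl) pred[m∸n]≡m∸[1+n]

ifZero : ℕ → ℕ → ℕ → ℕ
ifZero zero    x y = x
ifZero (suc _) x y = y

ifZero-computable : ∀ {B f g h} → ComputableIn B f → ComputableIn B g → ComputableIn B h →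
                    ComputableIn B (λ x → ifZero (f x) (g x) (h x))
ifZero-computable {B} {f} {g} {h} fᶜ gᶜ hᶜ =
  ext-computable
    (λ x → cong₂ (ifZero (f x)) (left-pair (g x) (h x)) (right-pair (g x) (h x)))
    (comp₂-computable (λ p n → ifZero n (left p) (right p)) branch (pair-computable gᶜ hᶜ) fᶜ)
  where
  branch : ComputableIn₂ B (λ p n → ifZero n (left p) (right p))
  -- Case distinction as a recursion whose step ignores the previous value; both branches travel in
  -- the parameter `p`.
  branch = prec-computable (λ p _ _ → right p) (λ p n → ifZero n (left p) (right p))
    (left-computable id-computable) (right-computable (left-computable id-computable))
    (λ _ → refl) (λ _ _ → refl)

least-zero : ∀ (h : ℕ → ℕ) n → h n ≡ 0 →
             ∃[ m ] (h m ≡ 0 × (∀ k → k < m → ∃[ r ] h k ≡ suc r))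
least-zero h n hn with h 0 in eq
least-zero h n       hn | zero  = 0 , eq , λ _ ()
least-zero h zero    hn | suc r = contradiction (trans (sym eq) hn) λ ()
least-zero h (suc n) hn | suc r with least-zero (h ∘ suc) n hn
... | m , hm , below = suc m , hm , λ where
  zero    _         → r , eq
  (suc k) (s≤s k<m) → below k k<m

-- The zero `n` guarantees that the search halts; the result `m` is the least zero and may differ
-- from `n`.
mu-eval : ∀ {B} h ((c , _) : ComputableIn₂ B h) x n → h x n ≡ 0 →
          ∃[ m ] (Eval B (muᶜ c) x m × h x m ≡ 0)
mu-eval {B} h hᶜ@(c , _) x n hn with least-zero (h x) n hn
... | m , hm , below =
      m
    , mu-ev (subst (Eval B c _) hm (eval₂ h hᶜ x m))
        (λ k k<m → proj₁ (below k k<m)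
                 , subst (Eval B c _) (proj₂ (below k k<m)) (eval₂ h hᶜ x k))
    , hm

-- Gödel numbers

-- With the tag separated from the payload, unifying equal tags discards all mixed pairs of
-- constructors, and `encode-injective` is left with the nine diagonal cases.
tag payload : Code → ℕ
tag zeroᶜ       = 0
tag succᶜ       = 1
tag leftᶜ       = 2
tag rightᶜ      = 3
tag oracleᶜ     = 4
tag (pairᶜ _ _) = 5
tag (compᶜ _ _) = 6
tag (precᶜ _ _) = 7
tag (muᶜ _)     = 8
payload (pairᶜ f g) = pair (encode f) (encode g)
payload (compᶜ f g) = pair (encode f) (encode g)
payload (precᶜ f g) = pair (encode f) (encode g)
payload (muᶜ f)     = encode f
payload _           = 0

encode-tag : ∀ c → encode c ≡ pair (tag c) (payload c)
encode-tag zeroᶜ       = refl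
encode-tag succᶜ       = refl
encode-tag leftᶜ       = refl
encode-tag rightᶜ      = refl
encode-tag oracleᶜ     = refl
encode-tag (pairᶜ _ _) = refl
encode-tag (compᶜ _ _) = refl
encode-tag (precᶜ _ _) = refl
encode-tag (muᶜ _)     = refl

encode-split : ∀ c {k n} → encode c ≡ pair k n → tag c ≡ k × payload c ≡ n
encode-split c eq = pair-injective (trans (sym (encode-tag c)) eq)

encode-injective : ∀ c d → encode c ≡ encode d → c ≡ d
encode-injective c d eq = uncurry (same c d) (encode-split c (trans eq (encode-tag d)))
  where
  same : ∀ c d → tag c ≡ tag d → payload c ≡ payload d → c ≡ d
  same zeroᶜ zeroᶜ refl _ = refl
  same succᶜ succᶜ refl _ = refl
  same leftᶜ leftᶜ refl _ = refl
  same rightᶜ rightᶜ refl _ = refl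
  same oracleᶜ oracleᶜ refl _ = refl
  same (pairᶜ f g) (pairᶜ f′ g′) refl eq with pair-injective eq
  ... | p , q = cong₂ pairᶜ (encode-injective f f′ p) (encode-injective g g′ q)
  same (compᶜ f g) (compᶜ f′ g′) refl eq with pair-injective eq
  ... | p , q = cong₂ compᶜ (encode-injective f f′ p) (encode-injective g g′ q)
  same (precᶜ f g) (precᶜ f′ g′) refl eq with pair-injective eq
  ... | p , q = cong₂ precᶜ (encode-injective f f′ p) (encode-injective g g′ q)
  same (muᶜ f) (muᶜ f′) refl eq = cong muᶜ (encode-injective f f′ eq)

-- ∅ ′ answers questions about the value of a program, not just about its halting:
-- `queryᶜ c n w` halts if and only if c halts on n with a value above w.

abstract
  greater : ∃[ c ] ((∀ {v w} → w < v → ∃[ y ] Eval ∅ c (pair v w) y) ×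
                    (∀ {v w y} → Eval ∅ c (pair v w) y → w < v))
  greater = muᶜ (proj₁ deficitᶜ) , halts , halts⁻¹
    where
    -- The search variable is ignored: the search stops at once if `suc w ∸ v` is 0, that is if
    -- `w < v`, and never otherwise.
    deficit : ℕ → ℕ → ℕ
    deficit p _ = suc (right p) ∸ left p

    deficitᶜ : ComputableIn₂ ∅ deficit
    deficitᶜ = comp₂-computable _∸_ ∸-computable
      (suc-computable (right-computable (left-computable id-computable)))
      (left-computable (left-computable id-computable))

    deficit-pair : ∀ v w m → deficit (pair v w) m ≡ suc w ∸ v
    deficit-pair v w _ = cong₂ (λ a b → suc a ∸ b) (right-pair v w) (left-pair v w)

    halts : ∀ {v w} → w < v → ∃[ y ] Eval ∅ (muᶜ (proj₁ deficitᶜ)) (pair v w) y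
    halts {v} {w} w<v
      with mu-eval deficit deficitᶜ (pair v w) 0
             (trans (deficit-pair v w 0) (m≤n⇒m∸n≡0 w<v))
    ... | m , ev , _ = m , ev

    halts⁻¹ : ∀ {v w y} → Eval ∅ (muᶜ (proj₁ deficitᶜ)) (pair v w) y → w < v
    halts⁻¹ {v} {w} (mu-ev {n = n} ev _) = m∸n≡0⇒m≤n (trans (sym (deficit-pair v w n))
      (eval-det (proj₁ deficitᶜ) (eval₂ deficit deficitᶜ (pair v w) n) ev))

  greaterᶜ : Code
  greaterᶜ = proj₁ greater

  greaterᶜ-halts : ∀ {v w} → w < v → ∃[ y ] Eval ∅ greaterᶜ (pair v w) y
  greaterᶜ-halts = proj₁ (proj₂ greater)

  greaterᶜ-halts⁻¹ : ∀ {v w y} → Eval ∅ greaterᶜ (pair v w) y → w < v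
  greaterᶜ-halts⁻¹ = proj₂ (proj₂ greater)

queryᶜ : Code → ℕ → ℕ → Code
queryᶜ c n w = compᶜ greaterᶜ (pairᶜ (compᶜ c (constᶜ n)) (constᶜ w))

-- `index` is an abstract copy of `encode`: unfolding the pairing function on the numbers of
-- programs during conversion checking is exponential.

abstract
  index : Code → ℕ
  index = encode

  encode≡index : ∀ c → encode c ≡ index c
  encode≡index _ = refl

  index-injective : ∀ c d → index c ≡ index d → c ≡ d
  index-injective = encode-injective

  compIndex pairIndex : ℕ → ℕ → ℕ
  compIndex m n = pair 6 (pair m n)
  pairIndex m n = pair 5 (pair m n)

  index-zero : index zeroᶜ ≡ 0
  index-zero = refl

  index-comp : ∀ f g → index (compᶜ f g) ≡ compIndex (index f) (index g)
  index-comp _ _ = refl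

  index-pair : ∀ f g → index (pairᶜ f g) ≡ pairIndex (index f) (index g)
  index-pair _ _ = refl

  compIndex-split : ∀ d {m n} → index d ≡ compIndex m n →
                    Σ[ f ∈ Code ] Σ[ g ∈ Code ] (d ≡ compᶜ f g × index f ≡ m × index g ≡ n)
  compIndex-split d {m} {n} eq with encode-split d {6} {pair m n} eq
  compIndex-split (compᶜ f g) eq | refl , eq′ = f , g , refl , pair-injective eq′

  pairIndex-split : ∀ d {m n} → index d ≡ pairIndex m n →
                    Σ[ f ∈ Code ] Σ[ g ∈ Code ] (d ≡ pairᶜ f g × index f ≡ m × index g ≡ n)
  pairIndex-split d {m} {n} eq with encode-split d {5} {pair m n} eq
  pairIndex-split (pairᶜ f g) eq | refl , eq′ = f , g , refl , pair-injective eq′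

  compIndex-computable : ∀ {B f g} → ComputableIn B f → ComputableIn B g →
                         ComputableIn B (λ x → compIndex (f x) (g x))
  compIndex-computable fᶜ gᶜ = pair-computable (const-computable 6) (pair-computable fᶜ gᶜ)

  pairIndex-computable : ∀ {B f g} → ComputableIn B f → ComputableIn B g →
                         ComputableIn B (λ x → pairIndex (f x) (g x))
  pairIndex-computable fᶜ gᶜ = pair-computable (const-computable 5) (pair-computable fᶜ gᶜ)

-- `queryᶜ` on the level of numbers. Here `e` is arbitrary; if it is not the number of a program,
-- then neither is the query (`query-split`), so the query lies outside `∅ ′`.
query : ℕ → ℕ → ℕ → ℕ
query e n w =
  compIndex (index greaterᶜ) (pairIndex (compIndex e (index (constᶜ n))) (index (constᶜ w)))

index-query : ∀ c n w → index (queryᶜ c n w) ≡ query (index c) n w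
index-query c n w
  rewrite index-comp greaterᶜ (pairᶜ (compᶜ c (constᶜ n)) (constᶜ w))
        | index-pair (compᶜ c (constᶜ n)) (constᶜ w)
        | index-comp c (constᶜ n) = refl

query-∈ : ∀ {c n v w} → Eval ∅ c n v → w < v → query (index c) n w ∈ ∅ ′
query-∈ {c} {n} {v} {w} ev w<v with greaterᶜ-halts w<v
-- The jump runs a program on its own number; `constᶜ n` discards that input.
... | y , gt = queryᶜ c n w , trans (encode≡index (queryᶜ c n w)) (index-query c n w) , y ,
  comp-ev (pair-ev (comp-ev (constᶜ-eval n) ev) (constᶜ-eval w)) gt

query-split : ∀ d e n w → index d ≡ query e n w → ∃[ c ] (d ≡ queryᶜ c n w × index c ≡ e)
query-split d e n w eq with compIndex-split d eq
... | f , g , refl , f≡ , g≡ with pairIndex-split g g≡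
... | g₁ , g₂ , refl , g₁≡ , g₂≡ with compIndex-split g₁ g₁≡
... | c , k , refl , c≡ , k≡
  with index-injective f greaterᶜ f≡ | index-injective k (constᶜ n) k≡
     | index-injective g₂ (constᶜ w) g₂≡
... | refl | refl | refl = c , refl , c≡

queryᶜ-halts⁻¹ : ∀ c n w {x y} → Eval ∅ (queryᶜ c n w) x y → ∃[ v ] (Eval ∅ c n v × w < v)
queryᶜ-halts⁻¹ c n w (comp-ev (pair-ev (comp-ev n-ev c-ev) w-ev) gt)
  with eval-det (constᶜ n) n-ev (constᶜ-eval n) | eval-det (constᶜ w) w-ev (constᶜ-eval w)
... | refl | refl = _ , c-ev , greaterᶜ-halts⁻¹ gt

query-∈⁻¹ : ∀ e n w → query e n w ∈ ∅ ′ →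
            ∃[ c ] (index c ≡ e × ∃[ v ] (Eval ∅ c n v × w < v))
query-∈⁻¹ e n w (d , d≡ , y , ev) =
  let c , d≡c , c≡e = query-split d e n w (trans (sym (encode≡index d)) d≡)
  in  c , c≡e , queryᶜ-halts⁻¹ c n w (subst (λ d → Eval ∅ d (query e n w) y) d≡c ev)

-- The requirement r = pair i e concerns the program with number e, which is run on `pair r l`.

request : ℕ → ℕ → ℕ
request p = query (right (left p)) p

request-computable : ∀ {B} → ComputableIn₂ B request
request-computable {B} =
  compIndex-computable (const-computable (index greaterᶜ))
    (pairIndex-computable
      (compIndex-computable (right-computable (left-computable (left-computable id-computable)))
                            (constᶜ-index (left-computable id-computable)))
      (constᶜ-index (right-computable id-computable)))
  where
  constᶜ-index : ∀ {f} → ComputableIn B f → ComputableIn B (λ x → index (constᶜ (f x)))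
  constᶜ-index = comp₂-computable (λ _ n → index (constᶜ n))
    (prec-computable (λ _ _ r → compIndex (index succᶜ) r) (λ _ n → index (constᶜ n))
      (const-computable 0)
      (compIndex-computable (const-computable (index succᶜ))
                            (right-computable (right-computable id-computable)))
      (λ _ → sym index-zero) (λ _ n → sym (index-comp succᶜ (constᶜ n))))
    (const-computable 0)

abstract
  requestᶜ : Code
  requestᶜ = proj₁ (request-computable {∅ ′})

  requestᶜ-eval : ∀ p w → Eval (∅ ′) requestᶜ (pair p w) (request p w)
  requestᶜ-eval = eval₂ request (request-computable {∅ ′})

-- Values of programs, computed from the jump

-- The oracle's answers 1 and 0 serve directly as the signals to continue and to stop. Without a
-- value the query fails already at 0, which yields the default value 0.
valueᶜ : Code
valueᶜ = muᶜ (compᶜ oracleᶜ requestᶜ)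

Value : ℕ → ℕ → Set
Value = Eval (∅ ′) valueᶜ

oracle-request-yes : ∀ {p w} → request p w ∈ ∅ ′ →
                     Eval (∅ ′) (compᶜ oracleᶜ requestᶜ) (pair p w) 1
oracle-request-yes {p} {w} yes∈ = comp-ev (requestᶜ-eval p w) (oracle-yes yes∈)

oracle-request-no : ∀ {p w} → request p w ∉ ∅ ′ →
                    Eval (∅ ′) (compᶜ oracleᶜ requestᶜ) (pair p w) 0
oracle-request-no {p} {w} no∉ = comp-ev (requestᶜ-eval p w) (oracle-no no∉)

-- The queries succeed below `v`, and at `v` determinism excludes a larger value.
value-eval : ∀ c p {v} → right (left p) ≡ index c → Eval ∅ c p v → Value p v
value-eval c p {v} e≡c ev = mu-ev (oracle-request-no v∉) (λ w w<v → 0 , oracle-request-yes (w∈ w<v))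
  where
  w∈ : ∀ {w} → w < v → request p w ∈ ∅ ′
  w∈ {w} w<v = subst (λ e → query e p w ∈ ∅ ′) (sym e≡c) (query-∈ ev w<v)

  v∉ : request p v ∉ ∅ ′
  v∉ v∈ with query-∈⁻¹ (right (left p)) p v v∈
  ... | d , d≡e , u , d-ev , v<u with index-injective d c (trans d≡e e≡c)
  ... | refl = <-irrefl (eval-det c ev d-ev) v<u

-- If the search had no result, no query could fail, since the first failure would be the result.
-- But success of the query at 0 provides a program with a value, and `value-eval` turns that value
-- into a result.
value-exists : ∀ p → ¬ ¬ (∃[ v ] Value p v)
value-exists p none = all∈ 1 λ below →
  let c , c≡e , v , ev , _ = query-∈⁻¹ (right (left p)) p 0 (below 0 (s≤s z≤n))
  in  none (v , value-eval c p (sym c≡e) ev)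
  where
  all∈ : ∀ n → ¬ ¬ (∀ w → w < n → request p w ∈ ∅ ′)
  all∈ zero    k = k λ _ ()
  all∈ (suc n) k = all∈ n λ below → none (n , mu-ev
    (oracle-request-no λ n∈ → k λ w w<1+n → extend below n∈ (m<1+n⇒m<n∨m≡n w<1+n))
    (λ w w<n → 0 , oracle-request-yes (below w w<n)))
    where
    extend : ∀ {w} → (∀ w → w < n → request p w ∈ ∅ ′) → request p n ∈ ∅ ′ →
             w < n ⊎ w ≡ n → request p w ∈ ∅ ′
    extend below n∈ (inj₁ w<n)  = below _ w<n
    extend below n∈ (inj₂ refl) = n∈

-- Stages of the construction

-- The next bound. As `left v ≤ v`, it exceeds both copies `pair 0 x` and `pair 1 x` of the number
-- `x = pair r (l + left v)` put in by requirement `r`; it also exceeds `v`.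
advance : ℕ → ℕ → ℕ → ℕ
advance r l v = suc (pair 1 (pair r (l + v)))

abstract
  advance-computable : ComputableIn₂ (∅ ′) (λ v p → advance (left p) (right p) v)
  advance-computable = suc-computable (pair-computable (const-computable 1)
    (pair-computable (left-computable (right-computable id-computable))
      (comp₂-computable _+_ +-computable (right-computable (right-computable id-computable))
                                         (left-computable id-computable))))

stageᶜ : Code
-- The input is `pair 0 (pair r l)`, with a dummy parameter 0 that `rightᶜ` removes.
stageᶜ = compᶜ (proj₁ advance-computable) (pairᶜ (compᶜ valueᶜ rightᶜ) rightᶜ)

-- A relation instead of a function, because existence of the bound is established only up to double
-- negation.
Bound : ℕ → ℕ → Set
Bound = Rec (∅ ′) zeroᶜ stageᶜ 0

stageᶜ-eval : ∀ r l {v} → Value (pair r l) v →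
              Eval (∅ ′) stageᶜ (pair 0 (pair r l)) (advance r l v)
stageᶜ-eval r l {v} ev =
  comp-ev (pair-ev (comp-ev right-ev′ ev) right-ev′)
    (subst (Eval (∅ ′) (proj₁ advance-computable) (pair v (pair r l)))
      (cong₂ (λ a b → advance a b v) (left-pair r l) (right-pair r l))
      (eval₂ (λ v p → advance (left p) (right p) v) advance-computable v (pair r l)))
  where
  right-ev′ : Eval (∅ ′) rightᶜ (pair 0 (pair r l)) (pair r l)
  right-ev′ = subst (Eval (∅ ′) rightᶜ (pair 0 (pair r l))) (right-pair 0 (pair r l)) right-ev

bound-det : ∀ {r l l′} → Bound r l → Bound r l′ → l ≡ l′
bound-det = rec-det zeroᶜ stageᶜ

bound-suc : ∀ {r l v} → Bound r l → Value (pair r l) v → Bound (suc r) (advance r l v)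
bound-suc {r} {l} bound value = rec-suc bound (stageᶜ-eval r l value)

bound-exists : ∀ r → ¬ ¬ (∃[ l ] Bound r l)
bound-exists zero    k = k (0 , rec-zero zero-ev)
bound-exists (suc r) k = bound-exists r λ (l , bound) → value-exists (pair r l) λ (v , value) →
  k (advance r l v , bound-suc {r} {l} bound value)

l+v<advance : ∀ r l v → l + v < advance r l v
l+v<advance r l v = s≤s (≤-trans (right≤pair r (l + v)) (right≤pair 1 (pair r (l + v))))

-- Induction on the later stage. The value used at that stage exists only up to double negation,
-- which is harmless because `≤` is decidable.
advance≤bound : ∀ {r l v r′ l′} → Bound r l → Value (pair r l) v → r < r′ → Bound r′ l′ →
                advance r l v ≤ l′
advance≤bound {r} {l} {v} {suc r′} {l′} bound value r<1+r′ bound′@(rec-suc {r = m} bound″ _) =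
  decidable-stable (advance r l v ≤? l′) λ k →
    value-exists (pair r′ m) λ (u , value″) → k (earlier u value″ (m<1+n⇒m<n∨m≡n r<1+r′))
  where
  earlier : ∀ u → Value (pair r′ m) u → r < r′ ⊎ r ≡ r′ → advance r l v ≤ l′
  earlier u value″ (inj₂ refl) = ≤-reflexive (bound-det (bound-suc {r} {l} bound value) bound′)
  earlier u value″ (inj₁ r<r′) = begin
    advance r l v   ≤⟨ advance≤bound bound value r<r′ bound″ ⟩
    m               ≤⟨ m≤m+n m u ⟩
    m + u           ≤⟨ <⇒≤ (l+v<advance r′ m u) ⟩
    advance r′ m u  ≡⟨ bound-det (bound-suc {r′} {m} bound″ value″) bound′ ⟩
    l′              ∎
    where open ≤-Reasoning

-- The generic set

distance : ℕ → ℕ → ℕ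
distance m n = (m ∸ n) + (n ∸ m)

distance≡0⇒≡ : ∀ {m n} → distance m n ≡ 0 → m ≡ n
distance≡0⇒≡ {m} {n} eq =
  ≤-antisym (m∸n≡0⇒m≤n (m+n≡0⇒m≡0 (m ∸ n) eq)) (m∸n≡0⇒m≤n (m+n≡0⇒n≡0 (m ∸ n) eq))

≡⇒distance≡0 : ∀ {m n} → m ≡ n → distance m n ≡ 0
≡⇒distance≡0 {m} refl = cong₂ _+_ (n∸n≡0 m) (n∸n≡0 m)

deviation : ℕ → ℕ → ℕ → ℕ
deviation x l v = distance (right x) (l + left v)

abstract
  deviation-computable : ComputableIn₃ (∅ ′) deviation
  deviation-computable = comp₂-computable _+_ +-computable
    (comp₂-computable _∸_ ∸-computable actual expected)
    (comp₂-computable _∸_ ∸-computable expected actual)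
    where
    actual : ComputableIn (∅ ′) (λ p → right (left p))
    actual = right-computable (left-computable id-computable)
    expected : ComputableIn (∅ ′) (λ p → left (right p) + left (right (right p)))
    expected = comp₂-computable _+_ +-computable
      (left-computable (right-computable id-computable))
      (left-computable (right-computable (right-computable id-computable)))

-- Only requirement `left x` can put `x` in, so membership is tested by recomputing the bound and
-- the value of that single requirement.
boundᶜ memberᶜ : Code
boundᶜ = compᶜ (precᶜ zeroᶜ stageᶜ) (pairᶜ zeroᶜ leftᶜ)
memberᶜ = compᶜ (proj₁ deviation-computable)
  (pairᶜ (proj₁ (id-computable {∅ ′})) (pairᶜ boundᶜ (compᶜ valueᶜ (pairᶜ leftᶜ boundᶜ))))

memberᶜ-eval : ∀ x {l v} → Bound (left x) l → Value (pair (left x) l) v →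
               Eval (∅ ′) memberᶜ x (deviation x l v)
memberᶜ-eval x {l} {v} bound value = comp-ev
  (pair-ev (proj₂ id-computable x) (pair-ev bound-ev (comp-ev (pair-ev left-ev bound-ev) value)))
  (eval₃ deviation deviation-computable x l v)
  where
  bound-ev : Eval (∅ ′) boundᶜ x l
  bound-ev = comp-ev (pair-ev zero-ev left-ev) (prec-ev
    (subst₂ (λ a n → Rec (∅ ′) zeroᶜ stageᶜ a n l)
      (sym (left-pair 0 (left x))) (sym (right-pair 0 (left x))) bound))

-- Stated as a result of `memberᶜ`, so that `eval-det` refutes membership wherever another result is
-- known.
Generic : Pred ℕ 0ℓ
Generic x = Eval (∅ ′) memberᶜ x 0

memberᶜ-halts : ∀ x → ¬ ¬ (∃[ d ] Eval (∅ ′) memberᶜ x d)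
memberᶜ-halts x k = bound-exists (left x) λ (l , bound) →
  value-exists (pair (left x) l) λ (v , value) → k (deviation x l v , memberᶜ-eval x bound value)

generic-intro : ∀ x {l v} → Bound (left x) l → Value (pair (left x) l) v →
                right x ≡ l + left v → x ∈ Generic
generic-intro x bound value eq =
  subst (Eval (∅ ′) memberᶜ x) (≡⇒distance≡0 eq) (memberᶜ-eval x bound value)

generic-elim : ∀ x {l v} → Bound (left x) l → Value (pair (left x) l) v →
               x ∈ Generic → right x ≡ l + left v
generic-elim x bound value x∈ =
  distance≡0⇒≡ (eval-det memberᶜ (memberᶜ-eval x bound value) x∈)
-- Let `y` come from requirement `r′`. If `r′ < r`, its copy `w` lies below `l`; if `r < r′`, then
-- `y` already exceeds `v`. So `r′ ≡ r`, and one requirement contributes one number. Decidable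
-- equality allows the bound and value of `r′` to be assumed.
generic-unique : ∀ r {l v} w → Bound r l → Value (pair r l) v → right w ∈ Generic →
                 left w ≤ 1 → l ≤ w → w ≤ v → right w ≡ pair r (l + left v)
generic-unique r {l} {v} w bound value y∈ left≤1 l≤w w≤v =
  decidable-stable (y ≟ pair r (l + left v)) λ k →
    bound-exists r′ λ (l′ , bound′) → value-exists (pair r′ l′) λ (v′ , value′) →
    k (compare bound′ value′ (generic-elim y bound′ value′ y∈) (<-cmp r′ r))
  where
  y r′ : ℕ
  y  = right w
  r′ = left y
  open ≤-Reasoning
  compare : ∀ {l′ v′} → Bound r′ l′ → Value (pair r′ l′) v′ → right y ≡ l′ + left v′ →
            Tri (r′ < r) (r′ ≡ r) (r < r′) → y ≡ pair r (l + left v)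
  compare {l′} {v′} bound′ value′ eq (tri< r′<r _ _) = contradiction (begin-strict
    w                                           ≡⟨ pair-unpair w ⟨
    pair (left w) y                             ≡⟨ cong (pair (left w)) (pair-unpair y) ⟨
    pair (left w) (pair r′ (right y))           ≡⟨ cong (λ n → pair (left w) (pair r′ n)) eq ⟩
    pair (left w) (pair r′ (l′ + left v′))      ≤⟨ pair-mono left≤1 (pair-mono {r′} ≤-refl
                                                     (+-monoʳ-≤ l′ (left≤ v′))) ⟩
    pair 1 (pair r′ (l′ + v′))                  <⟨ n<1+n _ ⟩
    advance r′ l′ v′                            ≤⟨ advance≤bound bound′ value′ r′<r bound ⟩
    l                                           ≤⟨ l≤w ⟩
    w                                           ∎) (<-irrefl refl)
  compare {l′} {v′} bound′ value′ eq (tri> _ _ r<r′) = contradiction (begin-strict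
    v                  ≤⟨ m≤n+m v l ⟩
    l + v              <⟨ l+v<advance r l v ⟩
    advance r l v      ≤⟨ advance≤bound bound value r<r′ bound′ ⟩
    l′                 ≤⟨ m≤m+n l′ (left v′) ⟩
    l′ + left v′       ≡⟨ eq ⟨
    right y            ≤⟨ right≤ y ⟩
    y                  ≤⟨ right≤ w ⟩
    w                  ≤⟨ w≤v ⟩
    v                  ∎) (<-irrefl refl)
  compare _ _ _ (tri≈ _ r′≡r _) = trans (sym (pair-unpair y)) (cong₂ pair r′≡r
    (generic-elim y (subst (λ n → Bound n l) (sym r′≡r) bound)
                    (subst (λ n → Value (pair n l) v) (sym r′≡r) value) y∈))

-- Rigidity under injective computable functions

-- Otherwise every `m ≤ l` has one of its two values below `l`. This sends `suc l` numbers into `l`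
-- places, and a collision contradicts that a value determines `m`.
unbounded : ∀ (W : ℕ → ℕ → ℕ) → (∀ s m t n → W s m ≡ W t n → m ≡ n) →
            ∀ l → ¬ ¬ (∃[ m ] (l ≤ W 0 m × l ≤ W 1 m))
unbounded W W-injective l k
  with pigeonhole (n<1+n l) (λ i → fromℕ< (proj₂ (small (toℕ i))))
  where
  small : ∀ m → ∃[ t ] W t m < l
  small m with ≤-<-connex l (W 0 m) | ≤-<-connex l (W 1 m)
  ... | inj₂ W₀<l | _         = 0 , W₀<l
  ... | inj₁ _    | inj₂ W₁<l = 1 , W₁<l
  ... | inj₁ l≤W₀ | inj₁ l≤W₁ = contradiction (m , l≤W₀ , l≤W₁) k
... | i , j , i<j , eq = <-irrefl (W-injective _ (toℕ i) _ (toℕ j) W≡W) i<j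
  where
  W≡W = trans (sym (toℕ-fromℕ< _)) (trans (cong toℕ eq) (toℕ-fromℕ< _))

module _ (f : ℕ → ℕ) (f-computable : Computable f) (f-injective : Injective _≡_ _≡_ f) where

  image : ℕ → ℕ → ℕ → ℕ → ℕ
  image r l t m = f (pair t (pair r (l + m)))

  escape : ℕ → ℕ → ℕ → ℕ
  escape l u w = (l ∸ w) + (w ∸ u)

  -- The number `u` has two roles: `left u` selects the candidate `pair r (l + left u)`, and `u`
  -- itself bounds the images of both its copies from above. A zero means that both images lie
  -- between `l` and `u`.
  miss : ℕ → ℕ → ℕ → ℕ
  miss r l u = escape l u (image r l 0 (left u)) + escape l u (image r l 1 (left u))

  abstract
    miss-computable : ComputableIn₂ ∅ (λ p u → miss (left p) (right p) u)
    miss-computable = comp₂-computable _+_ +-computable (escapeᶜ 0) (escapeᶜ 1)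
      where
      rᶜ : ComputableIn ∅ (λ q → left (left q))
      rᶜ = left-computable (left-computable id-computable)
      lᶜ : ComputableIn ∅ (λ q → right (left q))
      lᶜ = right-computable (left-computable id-computable)
      uᶜ : ComputableIn ∅ right
      uᶜ = right-computable id-computable
      imageᶜ : ∀ t → ComputableIn ∅ (λ q →
                 image (left (left q)) (right (left q)) t (left (right q)))
      imageᶜ t = comp-computable f-computable (pair-computable (const-computable t)
        (pair-computable rᶜ (comp₂-computable _+_ +-computable lᶜ (left-computable uᶜ))))
      escapeᶜ : ∀ t → ComputableIn ∅ (λ q → escape (right (left q)) (right q)
                  (image (left (left q)) (right (left q)) t (left (right q))))
      escapeᶜ t = comp₂-computable _+_ +-computable
        (comp₂-computable _∸_ ∸-computable lᶜ (imageᶜ t))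
        (comp₂-computable _∸_ ∸-computable (imageᶜ t) uᶜ)

  escape≡0 : ∀ {l u w} → l ≤ w → w ≤ u → escape l u w ≡ 0
  escape≡0 l≤w w≤u = cong₂ _+_ (m≤n⇒m∸n≡0 l≤w) (m≤n⇒m∸n≡0 w≤u)

  escape≡0⁻¹ : ∀ {l u w} → escape l u w ≡ 0 → l ≤ w × w ≤ u
  escape≡0⁻¹ {l} {u} {w} eq =
    m∸n≡0⇒m≤n (m+n≡0⇒m≡0 (l ∸ w) eq) , m∸n≡0⇒m≤n (m+n≡0⇒n≡0 (l ∸ w) eq)

  miss-vanishes : ∀ r l → ¬ ¬ (∃[ u ] miss r l u ≡ 0)
  miss-vanishes r l k = unbounded (image r l) image-injective l λ (m , l≤w₀ , l≤w₁) →
    -- The second component only makes `u` at least as large as both images; the first still selects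
    -- `m`.
    let w₀ = image r l 0 m; w₁ = image r l 1 m; u = pair m (w₀ + w₁)
    in  k (u , subst (λ n → escape l u (image r l 0 n) + escape l u (image r l 1 n) ≡ 0)
                 (sym (left-pair m (w₀ + w₁)))
                 (cong₂ _+_
                   (escape≡0 l≤w₀ (≤-trans (m≤m+n w₀ w₁) (right≤pair m (w₀ + w₁))))
                   (escape≡0 l≤w₁ (≤-trans (m≤n+m w₁ w₀) (right≤pair m (w₀ + w₁))))))
    where
    image-injective : ∀ s m t n → image r l s m ≡ image r l t n → m ≡ n
    image-injective s m t n eq = +-cancelˡ-≡ l m n
      (proj₂ (pair-injective {r} {l + m} {r} {l + n}
        (proj₂ (pair-injective {s} {pair r (l + m)} {t} {pair r (l + n)} (f-injective eq)))))

  -- The premises on `f (pair t x)` follow from membership in `Copies s′` for any `s′` bounded by 1,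
  -- so one statement serves all targets.
  Fixed : ℕ → Set
  Fixed x = ∀ t → t ≤ 1 → left (f (pair t x)) ≤ 1 → right (f (pair t x)) ∈ Generic →
            right (f (pair t x)) ≡ x

  -- The program `c` depends on `f` alone and reads `r` and `l` from its input, so
  -- `r = pair i (index c)` is formed without circularity. The images of both copies of the chosen
  -- `x` then fall into the interval of `generic-unique`.
  rigid : ∀ i → ¬ ¬ (∃[ x ] (left (left x) ≡ i × x ∈ Generic × Fixed x))
  rigid i k = bound-exists r λ (l , bound) → miss-vanishes r l λ (u , miss≡0) →
    let p = pair r l
        v , ev , miss≡0′ = mu-eval (λ p u → miss (left p) (right p) u) miss-computable p u
          (trans (cong₂ (λ a b → miss a b u) (left-pair r l) (right-pair r l)) miss≡0)
        value = value-eval c p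
          (trans (cong right (left-pair r l)) (right-pair i (index c))) ev
        miss≡0″ = trans (cong₂ (λ a b → miss a b v) (sym (left-pair r l)) (sym (right-pair r l)))
                    miss≡0′
    in k (outcome bound value miss≡0″)
    where
    c : Code
    c = muᶜ (proj₁ miss-computable)
    r : ℕ
    r = pair i (index c)
    outcome : ∀ {l v} → Bound r l → Value (pair r l) v → miss r l v ≡ 0 →
              ∃[ x ] (left (left x) ≡ i × x ∈ Generic × Fixed x)
    outcome {l} {v} bound value miss≡0 =
        x
      , trans (cong left left-x) (left-pair i (index c))
      , generic-intro x (subst (λ n → Bound n l) (sym left-x) bound)
          (subst (λ n → Value (pair n l) v) (sym left-x) value) (right-pair r (l + left v))
      , λ t t≤1 left≤1 y∈ → let l≤w , w≤v = between t≤1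
                            in  generic-unique r (f (pair t x)) bound value y∈ left≤1 l≤w w≤v
      where
      x : ℕ
      x = pair r (l + left v)
      left-x : left x ≡ r
      left-x = left-pair r (l + left v)
      between : ∀ {t} → t ≤ 1 → l ≤ f (pair t x) × f (pair t x) ≤ v
      between z≤n       = escape≡0⁻¹ (m+n≡0⇒m≡0 _ miss≡0)
      between (s≤s z≤n) = escape≡0⁻¹ (m+n≡0⇒n≡0 (escape l v (f (pair 0 x))) miss≡0)

-- Sets of copies and reductions between them

unique-lookup-injective : ∀ {xs : List ℕ} → Unique xs → ∀ i j → lookup xs i ≡ lookup xs j → i ≡ j
unique-lookup-injective (x∉ ∷ u) zero    zero    eq = refl
unique-lookup-injective (x∉ ∷ u) zero    (suc j) eq = contradiction eq (All.lookup x∉ (∈-lookup j))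
unique-lookup-injective (x∉ ∷ u) (suc i) zero    eq =
  contradiction (sym eq) (All.lookup x∉ (∈-lookup i))
unique-lookup-injective (x∉ ∷ u) (suc i) (suc j) eq =
  cong suc (unique-lookup-injective u i j eq)

-- The colouring is injective on each fibre, so the positions of a duplicate-free list of preimages
-- inject into `Fin c`.
fibresBounded : ∀ f c (colour : ℕ → Fin c) →
                (∀ x y → f x ≡ f y → colour x ≡ colour y → x ≡ y) → FibresBounded f c
fibresBounded f c colour separates y xs unique f≡y =
  injective⇒≤ {f = colour ∘ lookup xs} λ {i} {j} eq → unique-lookup-injective unique i j
    (separates _ _ (trans (All.lookup f≡y (∈-lookup i)) (sym (All.lookup f≡y (∈-lookup j)))) eq)

≤₁⇒≤bfo : ∀ X Y → X ≤₁ Y → X ≤bfo Y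
≤₁⇒≤bfo X Y (f , f-computable , f-injective , f-reduces) =
    f , 1 , s≤s z≤n , f-computable , f-reduces
  , fibresBounded f 1 (λ _ → zero) (λ _ _ eq _ → f-injective eq)

ifZero-≤ : ∀ {m n} x y → m ≤ n → ifZero (m ∸ n) x y ≡ x
ifZero-≤ x y m≤n = cong (λ d → ifZero d x y) (m≤n⇒m∸n≡0 m≤n)

ifZero-> : ∀ {m n} x y → n < m → ifZero (m ∸ n) x y ≡ y
ifZero-> {suc m} {zero}  x y _         = refl
ifZero-> {suc m} {suc n} x y (s≤s n<m) = ifZero-> x y n<m

-- Every x has suc (s x) copies pair 0 x, …, pair (s x) x; all other numbers are left out.

Copies : (ℕ → ℕ) → Pred ℕ 0ℓ
Copies s z = left z ≤ s (right z) × right z ∈ Generic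

module _ (s : ℕ → ℕ) (s≤1 : ∀ x → s x ≤ 1) (s-computable : Computable s) where

  -- Numbers that are not copies go to `pair 2 z`. This lies outside every `Copies s′` with `s′`
  -- bounded by 1, is injective in `z`, and avoids all values of `g` with left component at most 1.
  redirect : (ℕ → ℕ) → ℕ → ℕ
  redirect g z = ifZero (left z ∸ s (right z)) (g z) (pair 2 z)

  redirect-computable : ∀ {g} → Computable g → Computable (redirect g)
  redirect-computable g-computable = ifZero-computable
    (comp₂-computable _∸_ ∸-computable (left-computable id-computable)
      (comp-computable s-computable (right-computable id-computable)))
    g-computable (pair-computable (const-computable 2) id-computable)

  redirect-reduces : ∀ {s′} g → (∀ x → s′ x ≤ 1) →
                     (∀ z → left z ≤ s (right z) →
                        left (g z) ≤ s′ (right (g z)) × right (g z) ≡ right z) →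
                     ∀ z → z ∈ Copies s ⇔ redirect g z ∈ Copies s′
  redirect-reduces {s′} g s′≤1 g-copy z with ≤-<-connex (left z) (s (right z))
  ... | inj₁ copy rewrite ifZero-≤ (g z) (pair 2 z) copy = mk⇔
    (λ (_ , z∈) → proj₁ (g-copy z copy) , subst Generic (sym (proj₂ (g-copy z copy))) z∈)
    (λ (_ , gz∈) → copy , subst Generic (proj₂ (g-copy z copy)) gz∈)
  ... | inj₂ other rewrite ifZero-> (g z) (pair 2 z) other = mk⇔
    (λ (copy , _) → contradiction copy (<⇒≱ other))
    (λ (2≤ , _) → contradiction (≤-trans (≤-reflexive (sym (left-pair 2 z))) (≤-trans 2≤ (s′≤1 _)))
                    λ { (s≤s ()) })

  redirect-collision : ∀ g → (∀ z → left z ≤ s (right z) → left (g z) ≤ 1) →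
                       ∀ y z → redirect g y ≡ redirect g z →
                       y ≡ z ⊎ (left y ≤ s (right y) × left z ≤ s (right z) × g y ≡ g z)
  redirect-collision g g≤1 y z eq
    with ≤-<-connex (left y) (s (right y)) | ≤-<-connex (left z) (s (right z))
  ... | inj₁ cy | inj₁ cz = inj₂ (cy , cz ,
    trans (sym (ifZero-≤ _ _ cy)) (trans eq (ifZero-≤ _ _ cz)))
  ... | inj₂ oy | inj₂ oz = inj₁ (proj₂ (pair-injective {2} {y} {2} {z}
    (trans (sym (ifZero-> _ _ oy)) (trans eq (ifZero-> _ _ oz)))))
  ... | inj₁ cy | inj₂ oz = contradiction
    (≤-trans (≤-reflexive (trans (sym (left-pair 2 z)) (cong left
      (trans (sym (ifZero-> _ _ oz)) (trans (sym eq) (ifZero-≤ _ _ cy)))))) (g≤1 y cy))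
    λ { (s≤s ()) }
  ... | inj₂ oy | inj₁ cz = contradiction
    (≤-trans (≤-reflexive (trans (sym (left-pair 2 y)) (cong left
      (trans (sym (ifZero-> _ _ oy)) (trans eq (ifZero-≤ _ _ cz)))))) (g≤1 z cz))
    λ { (s≤s ()) }

  copies-mono : ∀ s′ → (∀ x → s′ x ≤ 1) → (∀ x → s x ≤ s′ x) → Copies s ≤₁ Copies s′
  copies-mono s′ s′≤1 s≤s′ =
      redirect id
    , redirect-computable id-computable
    , (λ {y} {z} eq → [ id , (λ (_ , _ , y≡z) → y≡z) ]′
         (redirect-collision id (λ z copy → ≤-trans copy (s≤1 _)) y z eq))
    , redirect-reduces id s′≤1 (λ z copy → ≤-trans copy (s≤s′ _) , refl)

  -- All copies of `x` are merged into the first. There are at most two, told apart by their left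
  -- component, whence the constant 2.
  copies-≤bfo : Copies s ≤bfo Copies (λ _ → 0)
  copies-≤bfo =
      redirect first , 2 , s≤s z≤n
    , redirect-computable (pair-computable (const-computable 0) (right-computable id-computable))
    , redirect-reduces first (λ _ → z≤n)
        (λ z _ → ≤-reflexive (left-pair 0 (right z)) , right-pair 0 (right z))
    , fibresBounded (redirect first) 2 (colour ∘ left) separates
    where
    first : ℕ → ℕ
    first z = pair 0 (right z)

    colour : ℕ → Fin 2
    colour zero    = zero
    colour (suc _) = suc zero

    colour-injective : ∀ {m n} → m ≤ 1 → n ≤ 1 → colour m ≡ colour n → m ≡ n
    colour-injective z≤n       z≤n       _ = refl
    colour-injective (s≤s z≤n) (s≤s z≤n) _ = refl

    separates : ∀ y z → redirect first y ≡ redirect first z →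
                colour (left y) ≡ colour (left z) → y ≡ z
    separates y z eq same
      with redirect-collision first
             (λ z _ → ≤-trans (≤-reflexive (left-pair 0 (right z))) z≤n) y z eq
    ... | inj₁ y≡z = y≡z
    ... | inj₂ (cy , cz , first≡) = trans (sym (pair-unpair y)) (trans
      (cong₂ pair (colour-injective (≤-trans cy (s≤1 _)) (≤-trans cz (s≤1 _)) same)
                  (proj₂ (pair-injective {0} {right y} {0} {right z} first≡)))
      (pair-unpair z))

-- Reduction to the jump

-- Equals 1 exactly when the copy index `a` and the deviation `d` both vanish, that is, for the
-- first copy of an element of `Generic`.
characteristic : ℕ → ℕ → ℕ
characteristic a d = 1 ∸ (a + d)

abstract
  characteristic-computable : ComputableIn₂ (∅ ′) characteristic
  characteristic-computable = comp₂-computable _∸_ ∸-computable (const-computable 1)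
    (comp₂-computable _+_ +-computable (left-computable id-computable)
                                       (right-computable id-computable))

copies-≤T : Copies (λ _ → 0) ≤T ∅ ′
copies-≤T = c , λ z →
    (λ none → memberᶜ-halts (right z) λ (d , ev) → none (_ , comp-ev
      (pair-ev left-ev (comp-ev right-ev ev))
      (eval₂ characteristic characteristic-computable (left z) d)))
  , correct z
  where
  c : Code
  c = compᶜ (proj₁ characteristic-computable) (pairᶜ leftᶜ (compᶜ memberᶜ rightᶜ))

  decide : ∀ z a d → left z ≡ a → Eval (∅ ′) memberᶜ (right z) d →
           χ (Copies (λ _ → 0)) z (characteristic a d)
  decide z zero    zero    left≡ ev = inj₁ ((≤-reflexive left≡ , ev) , refl)
  decide z zero    (suc d) left≡ ev =
    inj₂ ((λ (_ , z∈) → contradiction (eval-det memberᶜ ev z∈) λ ()) , 0∸n≡0 d)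
  decide z (suc a) d       left≡ ev =
    inj₂ ((λ (left≤0 , _) → contradiction (trans (sym left≡) (n≤0⇒n≡0 left≤0)) λ ())
         , 0∸n≡0 (a + d))

  correct : ∀ z y → Eval (∅ ′) c z y → χ (Copies (λ _ → 0)) z y
  correct z y (comp-ev (pair-ev {z = d} left-ev (comp-ev right-ev ev)) ev′) =
    subst (χ (Copies (λ _ → 0)) z)
      (eval-det (proj₁ characteristic-computable)
        (eval₂ characteristic characteristic-computable (left z) d) ev′)
      (decide z (left z) d refl ev)

-- Non-reducibility

-- The double negation in `rigid` costs nothing here, the conclusion being a negation. In row `i`
-- the target has only the copy `pair 0 x`, and both copies of `x` must go there.
copies-≰₁ : ∀ i (s s′ : ℕ → ℕ) → (∀ x → s′ x ≤ 1) → (∀ x → left (left x) ≡ i → 1 ≤ s x) →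
            (∀ x → left (left x) ≡ i → s′ x ≡ 0) → ¬ (Copies s ≤₁ Copies s′)
copies-≰₁ i s s′ s′≤1 double single (f , f-computable , f-injective , f-reduces) =
  rigid f f-computable f-injective i λ (x , x≡i , x∈ , fixed) →
    let copy-∈ : ∀ t → t ≤ 1 → f (pair t x) ∈ Copies s′
        copy-∈ t t≤1 = Equivalence.to (f-reduces (pair t x))
          ( subst₂ _≤_ (sym (left-pair t x)) (cong s (sym (right-pair t x)))
              (≤-trans t≤1 (double x x≡i))
          , subst Generic (sym (right-pair t x)) x∈)
        to-first : ∀ t → t ≤ 1 → f (pair t x) ≡ pair 0 x
        to-first t t≤1 =
          let left≤ , right∈ = copy-∈ t t≤1
              right≡ = fixed t t≤1 (≤-trans left≤ (s′≤1 _)) right∈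
          in  trans (sym (pair-unpair (f (pair t x)))) (cong₂ pair
                (n≤0⇒n≡0 (≤-trans left≤ (≤-reflexive (trans (cong s′ right≡) (single x x≡i)))))
                right≡)
    in  contradiction
          (proj₁ (pair-injective {0} {x} {1} {x}
            (f-injective (trans (to-first 0 z≤n) (sym (to-first 1 ≤-refl))))))
          λ ()

-- The embedded family

module _ {_⪯_ : Rel ℕ 0ℓ} (po : IsPartialOrder _≡_ _⪯_) (⪯-computable : ComputableRel _⪯_) where

  open IsPartialOrder po using () renaming (refl to ⪯-refl; trans to ⪯-trans; antisym to ⪯-antisym)

  test : ℕ → ℕ → ℕ
  test i j = proj₁ ⪯-computable (pair i j)

  test-correct : ∀ i j → (i ⪯ j × test i j ≡ 1) ⊎ (¬ i ⪯ j × test i j ≡ 0)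
  test-correct i j = subst₂ (λ a b → (a ⪯ b × test i j ≡ 1) ⊎ (¬ a ⪯ b × test i j ≡ 0))
    (left-pair i j) (right-pair i j) (proj₂ (proj₂ ⪯-computable) (pair i j))

  multiplicity : ℕ → ℕ → ℕ
  multiplicity i x = test (left (left x)) i

  multiplicity-computable : ∀ i → Computable (multiplicity i)
  multiplicity-computable i = comp-computable (proj₁ (proj₂ ⪯-computable))
    (pair-computable (left-computable (left-computable id-computable)) (const-computable i))

  test≡1 : ∀ i j → i ⪯ j → test i j ≡ 1
  test≡1 i j i⪯j with test-correct i j
  ... | inj₁ (_ , eq)   = eq
  ... | inj₂ (i⋠j , _) = contradiction i⪯j i⋠j

  test≤1 : ∀ i j → test i j ≤ 1
  test≤1 i j with test-correct i j
  ... | inj₁ (_ , eq) = ≤-reflexive eq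
  ... | inj₂ (_ , eq) = ≤-trans (≤-reflexive eq) z≤n

  test-mono : ∀ k {i j} → i ⪯ j → test k i ≤ test k j
  test-mono k {i} {j} i⪯j with test-correct k i
  ... | inj₁ (k⪯i , eq) = ≤-reflexive (trans eq (sym (test≡1 k j (⪯-trans k⪯i i⪯j))))
  ... | inj₂ (_ , eq)   = ≤-trans (≤-reflexive eq) z≤n

  multiplicity≤1 : ∀ i x → multiplicity i x ≤ 1
  multiplicity≤1 i x = test≤1 (left (left x)) i

  Family : ℕ → Pred ℕ 0ℓ
  Family i = Copies (multiplicity i)

  family-≡bfo : ∀ i → Family i ≡bfo Copies (λ _ → 0)
  family-≡bfo i =
      copies-≤bfo (multiplicity i) (multiplicity≤1 i) (multiplicity-computable i)
    , ≤₁⇒≤bfo (Copies (λ _ → 0)) (Family i)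
        (copies-mono (λ _ → 0) (λ _ → z≤n) (const-computable 0)
           (multiplicity i) (multiplicity≤1 i) (λ _ → z≤n))

  family-mono : ∀ {i j} → i ⪯ j → Family i ≤₁ Family j
  family-mono {i} {j} i⪯j = copies-mono
    (multiplicity i) (multiplicity≤1 i) (multiplicity-computable i)
    (multiplicity j) (multiplicity≤1 j) (λ x → test-mono (left (left x)) i⪯j)

  -- The computable test decides `⪯`, so it is enough to refute the case in which `i ⪯ j` fails.
  family-cancel : ∀ {i j} → Family i ≤₁ Family j → i ⪯ j
  family-cancel {i} {j} Bᵢ≤Bⱼ with test-correct i j
  ... | inj₁ (i⪯j , _) = i⪯j
  ... | inj₂ (_ , eq)  = contradiction Bᵢ≤Bⱼ
    (copies-≰₁ i (multiplicity i) (multiplicity j) (multiplicity≤1 j)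
      -- Row `i` separates the two sets: reflexivity gives its elements two copies in `Family i`,
      -- and failure of `i ⪯ j` leaves one in `Family j`.
      (λ x x≡i → ≤-reflexive (sym (trans (cong (λ k → test k i) x≡i) (test≡1 i i ⪯-refl))))
      (λ x x≡i → trans (cong (λ k → test k j) x≡i) eq))

corollary3p10 : (_⪯_ : Rel ℕ 0ℓ) → IsPartialOrder _≡_ _⪯_ → ComputableRel _⪯_ →
    Σ[ A ∈ Pred ℕ 0ℓ ] Σ[ B ∈ (ℕ → Pred ℕ 0ℓ) ]
    ( A ≤T ∅ ′
    × Σ[ B≡A ∈ (∀ i → B i ≡bfo A) ]
    ( (∀ i j → B i ≤₁ B j ⇔ i ⪯ j)
    × IsOrderMonomorphism _≡_ (Poset._≈_ (1-degreesIn A)) _⪯_ (Poset._≤_ (1-degreesIn A)) (λ i → B i , B≡A i) ) )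
corollary3p10 _⪯_ po ⪯-computable =
    Copies (λ _ → 0) , Family po ⪯-computable
  , copies-≤T
  , family-≡bfo po ⪯-computable
  , (λ i j → mk⇔ (family-cancel po ⪯-computable) (family-mono po ⪯-computable))
  , record
    { isOrderHomomorphism = record
      { cong = λ { {i} refl → ≤₁-refl (B i) , ≤₁-refl (B i) }
      ; mono = family-mono po ⪯-computable
      }
    ; injective = λ (p , q) →
        IsPartialOrder.antisym po (family-cancel po ⪯-computable p)
                                  (family-cancel po ⪯-computable q)
    ; cancel    = family-cancel po ⪯-computable
    }
  where
  B : ℕ → Pred ℕ 0ℓ
  B = Family po ⪯-computable
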